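{- The $k$-Treewidth problem on $n$-vertex graphs can be solved by a deterministic one-pass streaming algorithm using $O(k\cdot n)$ space in insertion-only streams and $\widetilde{O}(k\cdot n)$ space in insertion-deletion streams.
   Context: $k$-Treewidth: given an undirected graph $G$, decide whether the treewidth of $G$ is at most $k$. Streaming model: the $n$ vertices are fixed, edges arrive one by one (insertion-only: only insertions; insertion-deletion: insertions and deletions). Space is measured in words of $O(\log n)$ bits; $\widetilde{O}$ hides $\log^{O(1)} n$ factors; unbounded computation is allowed. -}

module Defs where

open import Data.Nat using (ℕ; zero; suc; _+_; _*_; _^_; _≤_; _<_)
open import Data.Nat.Logarithm using (⌈log₂_⌉)
open import Data.Fin using (Fin; toℕ; _≟_)
open import Data.Fin.Subset using (Subset; _∈_; ∣_∣)
open import Data.List using (List; []; _∷_; length; map; foldl)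
open import Data.List.Relation.Unary.All using (All)
open import Data.List.Relation.Unary.Unique.Propositional using (Unique)
open import Data.Vec using (Vec)
open import Data.Bool using (Bool; true; false; if_then_else_; _∧_)
open import Data.Product using (Σ; _×_; _,_)
open import Data.Sum using (_⊎_)
open import Data.Unit using (⊤)
open import Relation.Nullary using (¬_)
open import Relation.Nullary.Decidable using (⌊_⌋)
open import Relation.Binary.PropositionalEquality using (_≡_)

Rel′ : ℕ → Set₁
Rel′ n = Fin n → Fin n → Set

data Walk {m : ℕ} (R : Rel′ m) : Fin m → Fin m → List (Fin m) → Set where
  here : ∀ {a} → Walk R a a (a ∷ [])
  _∷ʷ_ : ∀ {a b c xs} → R a b → Walk R b c xs → Walk R a c (a ∷ xs)

ConnectedWithin : {m : ℕ} → Rel′ m → (Fin m → Set) → Fin m → Fin m → Set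
ConnectedWithin {m} R P a b = Σ (List (Fin m)) λ xs → Walk R a b xs × All P xs

Connected : {m : ℕ} → Rel′ m → Set
Connected R = ∀ a b → ConnectedWithin R (λ _ → ⊤) a b

HasCycle : {m : ℕ} → Rel′ m → Set
HasCycle {m} R = Σ (Fin m) λ a → Σ (Fin m) λ b → Σ (List (Fin m)) λ xs →
  Walk R a b xs × R b a × 3 ≤ length xs × Unique xs

IsTree : (m : ℕ) → Rel′ m → Set
IsTree m T = (0 < m) × (∀ {s t} → T s t → T t s) × (∀ {t} → ¬ T t t)
           × Connected T × ¬ HasCycle T

record TreeDecomposition {n : ℕ} (E : Rel′ n) (k : ℕ) : Set₁ where
  field
    m          : ℕ
    T          : Rel′ m
    tree       : IsTree m T
    bag        : Fin m → Subset n
    vertexCov  : ∀ v → Σ (Fin m) λ t → v ∈ bag t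
    edgeCov    : ∀ u v → E u v → Σ (Fin m) λ t → (u ∈ bag t × v ∈ bag t)
    coherent   : ∀ v t₁ t₂ → v ∈ bag t₁ → v ∈ bag t₂ →
                 ConnectedWithin T (λ t → v ∈ bag t) t₁ t₂
    width≤k    : ∀ t → ∣ bag t ∣ ≤ suc k      -- width = max bag size − 1

TreewidthAtMost : {n : ℕ} → ℕ → Rel′ n → Set₁
TreewidthAtMost k E = TreeDecomposition E k

data Update (n : ℕ) : Set where
  ins del : Fin n → Fin n → Update n

-- current edge set; edge {u,v} with u < v is stored at (u , v)
EdgeState : ℕ → Set
EdgeState n = Fin n → Fin n → Bool

emptyES : {n : ℕ} → EdgeState n
emptyES _ _ = false

setES : {n : ℕ} → EdgeState n → Fin n → Fin n → Bool → EdgeState n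
setES f u v b x y = if ⌊ x ≟ u ⌋ ∧ ⌊ y ≟ v ⌋ then b else f x y

runES : {n : ℕ} → EdgeState n → List (Update n) → EdgeState n
runES f []              = f
runES f (ins u v ∷ s)   = runES (setES f u v true) s
runES f (del u v ∷ s)   = runES (setES f u v false) s

Valid : {n : ℕ} → EdgeState n → List (Update n) → Set
Valid f []            = ⊤
Valid f (ins u v ∷ s) = toℕ u < toℕ v × f u v ≡ false × Valid (setES f u v true) s
Valid f (del u v ∷ s) = toℕ u < toℕ v × f u v ≡ true  × Valid (setES f u v false) s

graphOf : {n : ℕ} → List (Update n) → Rel′ n
graphOf s x y = (runES emptyES s x y ≡ true) ⊎ (runES emptyES s y x ≡ true)

insertions : {n : ℕ} → List (Fin n × Fin n) → List (Update n)
insertions = map (λ { (u , v) → ins u v })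

-- Deterministic one-pass streaming algorithms with b bits of memory
-- (arbitrary, unbounded computation per token)

record StreamAlg (Tok : Set) (b : ℕ) : Set where
  field
    init   : Vec Bool b
    step   : Vec Bool b → Tok → Vec Bool b
    accept : Vec Bool b → Bool

runAlg : {Tok : Set} {b : ℕ} → StreamAlg Tok b → List Tok → Bool
runAlg A s = StreamAlg.accept A (foldl (StreamAlg.step A) (StreamAlg.init A) s)

-- bits in one word, Θ(log n)
word : ℕ → ℕ
word n = ⌈log₂ n ⌉ + 1

{-# OPTIONS --safe #-}
-- A graph has treewidth at most k iff its vertices can be eliminated one by one, each having
-- at most k neighbours when it is eliminated, where eliminating a vertex turns its
-- neighbourhood into a clique.  This makes treewidth decidable, and shows that a graph of
-- treewidth at most k has at most k n edges.
--
-- Sets of at most d edges can be told apart by a sketch of O(d log n) bits: assign to every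
-- vertex pair a bit vector such that no nonempty set of at most 2 d of these vectors XORs to
-- zero (they exist by the Gilbert–Varshamov counting argument), and store the XOR over the
-- present edges.  An insertion or a deletion XORs one vector into the sketch.  The number of
-- edges is stored too: the algorithm rejects when there are too many, and otherwise finds the
-- graph by exhaustive search over the sparse edge sets with the given sketch.
module Submission where

open import Defs
open import Data.Nat using (ℕ; zero; suc; pred; _+_; _*_; _∸_; _^_; _≤_; _<_; z≤n; s≤s; _≤?_; _<?_; ⌊_/2⌋; ⌈_/2⌉)
open import Data.Nat.Properties using (≤-refl; ≤-trans; ≤-reflexive; ≤-pred; ≤-<-trans; <⇒≤; <-irrefl; ≮⇒≥; ≤⇒≯; n≤1+n; n<1+n; m≤m+n; m<m+n; m≤n⇒m≤1+n; m<n+o⇒m∸n<o; m+[n∸m]≡n; +-suc; +-comm; +-identityʳ; +-mono-≤; +-monoˡ-≤; *-mono-<; *-monoʳ-≤; ^-monoˡ-≤; ^-monoʳ-<; ^-distribˡ-+-*; ^-*-assoc; ^-identityʳ; m^n>0; m^n≢0; ⌊n/2⌋+⌈n/2⌉≡n; ⌊n/2⌋≤⌈n/2⌉; ⌈n/2⌉<n; module ≤-Reasoning)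
open import Data.Nat.Logarithm using (⌈log₂_⌉; ⌈log₂⌉-mono-≤; ⌈log₂⌈n/2⌉⌉≡⌈log₂n⌉∸1)
open import Data.Nat.Induction using (<-rec)
open import Data.Nat.Solver using (module +-*-Solver)
open +-*-Solver using (solve; con; _:+_; _:*_; _:=_)
open import Data.Fin using (Fin; zero; suc; toℕ; _≟_; punchIn; punchOut; combine)
open import Data.Fin.Properties using (any?; punchIn-injective; punchInᵢ≢i; punchIn-punchOut; punchOut-punchIn; punchOut-cong; combine-injectiveˡ; combine-injectiveʳ; combine-surjective)
open import Data.Fin.Subset using (Subset; _∈_; _∉_; _⊆_; ∣_∣; ⊥; ⊤; _-_; ⁅_⁆; _∪_; Empty)
open import Data.Fin.Subset.Properties using (_∈?_; nonempty?; anySubset?; ∣p∣≤n; ∉⊥; ∣⊥∣≡0; ∈⊤; ∣⊤∣≡n; x∈⁅x⁆; x∈⁅y⁆⇒x≡y; p⊆q⇒∣p∣≤∣q∣; x∈p∪q⁻; x∈p∪q⁺; p─q⊆p; x∈p∧x≢y⇒x∈p-y; x∈p⇒∣p-x∣<∣p∣; p─⊥≡p)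
open import Data.Bool as Bool using (Bool; true; false; not; _∧_; _∨_; _xor_)
open import Data.Bool.Properties using (T-≡; not-involutive; ∨-comm; xor-assoc; xor-comm; xor-same; xor-identityˡ)
open import Data.List using (List; []; _∷_; _++_; length; map; foldl)
open import Data.List.Properties using (length-++; length-map)
open import Data.List.Membership.Propositional using () renaming (_∈_ to _∈ˡ_; _∉_ to _∉ˡ_)
open import Data.List.Membership.Propositional.Properties using (∈-++⁺ˡ; ∈-++⁺ʳ; ∈-map⁺)
open import Data.List.Membership.DecPropositional using () renaming (_∈?_ to mem?)
open import Data.List.Relation.Unary.Any using (here; there)
open import Data.List.Relation.Unary.All as All using (All; []; _∷_)
open import Data.List.Relation.Unary.All.Properties using (All¬⇒¬Any; ¬Any⇒All¬) renaming (map⁺ to All-map⁺)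
open import Data.List.Relation.Unary.AllPairs using ([]; _∷_)
open import Data.List.Relation.Unary.Unique.Propositional using (Unique)
open import Data.List.Relation.Unary.Unique.Propositional.Properties using () renaming (map⁺ to Unique-map⁺; map⁻ to Unique-map⁻)
open import Data.List.Relation.Binary.Subset.Propositional using () renaming (_⊆_ to _⊆ˡ_)
open import Data.Vec using (Vec; []; _∷_; here; there; lookup; tabulate; zipWith; replicate; updateAt; take; drop) renaming (_++_ to _++ᵛ_)
open import Data.Vec.Properties using (lookup∘tabulate; lookup⇒[]=; []=⇒lookup; lookup-replicate; lookup∘updateAt; lookup∘updateAt′; updateAt-updateAt; updateAt-id-local; zipWith-assoc; zipWith-comm; zipWith-identityˡ; ≡-dec)
open import Data.Product using (Σ; ∃; _×_; _,_; proj₁; proj₂)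
open import Data.Sum using (_⊎_; inj₁; inj₂)
import Data.Empty
open import Data.Unit using (tt)
open import Function using (_∘_; id)
open import Function.Bundles using (_⇔_; mk⇔; Equivalence)
open import Relation.Nullary using (¬_; Dec; yes; no; contradiction)
open import Relation.Nullary.Decidable using (⌊_⌋; _×-dec_; _⊎-dec_; ¬?; decidable-stable; toWitness; fromWitness)
open import Relation.Binary.PropositionalEquality using (_≡_; _≢_; refl; sym; trans; cong; cong₂; subst; subst₂; module ≡-Reasoning)

-- Finite subsets and Boolean connectives

x∉p-x : ∀ {n} (p : Subset n) x → x ∉ p - x
x∉p-x (_ ∷ p) zero    ()
x∉p-x (_ ∷ p) (suc x) (there x∈) = x∉p-x p x x∈

x∈p-y⇒x≢y : ∀ {n} {p : Subset n} {x y} → x ∈ p - y → x ≢ y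
x∈p-y⇒x≢y {p = p} x∈ refl = x∉p-x p _ x∈

p-x⊆p : ∀ {n} (p : Subset n) x → p - x ⊆ p
p-x⊆p p x = p─q⊆p p ⁅ x ⁆

∣p∣≤1+∣p-x∣ : ∀ {n} (p : Subset n) x → ∣ p ∣ ≤ suc ∣ p - x ∣
∣p∣≤1+∣p-x∣ (true  ∷ p) zero    = s≤s (≤-reflexive (cong ∣_∣ (sym (p─⊥≡p p))))
∣p∣≤1+∣p-x∣ (false ∷ p) zero    = m≤n⇒m≤1+n (≤-reflexive (cong ∣_∣ (sym (p─⊥≡p p))))
∣p∣≤1+∣p-x∣ (true  ∷ p) (suc x) = s≤s (∣p∣≤1+∣p-x∣ p x)
∣p∣≤1+∣p-x∣ (false ∷ p) (suc x) = ∣p∣≤1+∣p-x∣ p x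

∣p∣≤length : ∀ {n} (p : Subset n) (l : List (Fin n)) → (∀ {x} → x ∈ p → x ∈ˡ l) → ∣ p ∣ ≤ length l
∣p∣≤length {n} p []      p⊆l = ≤-trans (p⊆q⇒∣p∣≤∣q∣ {p = p} {⊥} (λ x∈p → contradiction (p⊆l x∈p) λ ())) (≤-reflexive (∣⊥∣≡0 n))
∣p∣≤length p (x ∷ l) p⊆l = ≤-trans (∣p∣≤1+∣p-x∣ p x) (s≤s (∣p∣≤length (p - x) l λ y∈ →
  tail (x∈p-y⇒x≢y {p = p} y∈) (p⊆l (p-x⊆p p x y∈))))
  where
  tail : ∀ {y} → y ≢ x → y ∈ˡ x ∷ l → y ∈ˡ l
  tail y≢x (here y≡x) = contradiction y≡x y≢x
  tail y≢x (there y∈) = y∈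

elements : ∀ {n} → Subset n → List (Fin n)
elements []          = []
elements (true  ∷ p) = zero ∷ map suc (elements p)
elements (false ∷ p) = map suc (elements p)

length-elements : ∀ {n} (p : Subset n) → length (elements p) ≡ ∣ p ∣
length-elements []          = refl
length-elements (true  ∷ p) = cong suc (trans (length-map suc (elements p)) (length-elements p))
length-elements (false ∷ p) = trans (length-map suc (elements p)) (length-elements p)

∈-elements : ∀ {n} {p : Subset n} {x} → x ∈ p → x ∈ˡ elements p
∈-elements {p = true  ∷ p} here       = here refl
∈-elements {p = true  ∷ p} (there x∈) = there (∈-map⁺ suc (∈-elements x∈))
∈-elements {p = false ∷ p} (there x∈) = ∈-map⁺ suc (∈-elements x∈)

∨-≡true⁻ : ∀ a {b} → a ∨ b ≡ true → a ≡ true ⊎ b ≡ true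
∨-≡true⁻ true  _  = inj₁ refl
∨-≡true⁻ false eq = inj₂ eq

∨-≡true⁺ : ∀ a {b} → a ≡ true ⊎ b ≡ true → a ∨ b ≡ true
∨-≡true⁺ true  _           = refl
∨-≡true⁺ false (inj₂ refl) = refl

∧-≡true⁻ : ∀ a {b} → a ∧ b ≡ true → a ≡ true × b ≡ true
∧-≡true⁻ true eq = refl , eq

∧-≡true⁺ : ∀ {a b} → a ≡ true → b ≡ true → a ∧ b ≡ true
∧-≡true⁺ refl refl = refl

≟-≡true⁻ : ∀ {n} {x y : Fin n} → ⌊ x ≟ y ⌋ ≡ true → x ≡ y
≟-≡true⁻ {x = x} {y} eq with yes x≡y ← x ≟ y = x≡y

≟-refl : ∀ {n} (x : Fin n) → ⌊ x ≟ x ⌋ ≡ true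
≟-refl x with x ≟ x
... | yes _  = refl
... | no x≢x = contradiction refl x≢x

-- Elimination orders

Adj : ℕ → Set
Adj n = Fin n → Fin n → Bool

Symmetric : ∀ {n} → Adj n → Set
Symmetric E = ∀ {x y} → E x y ≡ true → E y x ≡ true

-- A neighbour of `v` acquires a loop here, which is why the edge covers and cliques below only
-- speak of distinct vertices.
fill : ∀ {n} → Fin n → Adj n → Adj n
fill v E x y = E x y ∨ E x v ∧ E v y

fill-sym : ∀ {n} {v : Fin n} {E} → Symmetric E → Symmetric (fill v E)
fill-sym {v = v} {E} E-sym {x} {y} eq with ∨-≡true⁻ (E x y) eq
... | inj₁ e = ∨-≡true⁺ (E y x) (inj₁ (E-sym e))
... | inj₂ e with ∧-≡true⁻ (E x v) e
... | xv , vy = ∨-≡true⁺ (E y x) (inj₂ (∧-≡true⁺ (E-sym vy) (E-sym xv)))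

-- The neighbourhood is closed: it contains v itself, so it has the size of a bag.
nbhd : ∀ {n} → Subset n → Adj n → Fin n → Subset n
nbhd S E v = tabulate λ x → lookup S x ∧ (⌊ x ≟ v ⌋ ∨ E v x)

∈-nbhd⁻ : ∀ {n} {S : Subset n} {E v x} → x ∈ nbhd S E v → x ∈ S × (x ≡ v ⊎ E v x ≡ true)
∈-nbhd⁻ {S = S} {E} {v} {x} x∈
  with x∈S , eq ← ∧-≡true⁻ (lookup S x) (trans (sym (lookup∘tabulate _ x)) ([]=⇒lookup x∈))
  with ∨-≡true⁻ ⌊ x ≟ v ⌋ eq
... | inj₁ x≡v = lookup⇒[]= x S x∈S , inj₁ (≟-≡true⁻ x≡v)
... | inj₂ e   = lookup⇒[]= x S x∈S , inj₂ e

∈-nbhd⁺ : ∀ {n} {S : Subset n} {E v x} → x ∈ S → x ≡ v ⊎ E v x ≡ true → x ∈ nbhd S E v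
∈-nbhd⁺ {S = S} {E} {v} {x} x∈S d =
  lookup⇒[]= x _ (trans (lookup∘tabulate _ x) (∧-≡true⁺ ([]=⇒lookup x∈S) (∨-≡true⁺ ⌊ x ≟ v ⌋ (case d))))
  where
  case : x ≡ v ⊎ E v x ≡ true → ⌊ x ≟ v ⌋ ≡ true ⊎ E v x ≡ true
  case (inj₁ refl) = inj₁ (≟-refl x)
  case (inj₂ e)    = inj₂ e

-- S is the set of vertices still present; the adjacency outside S is ignored.
Elim : ∀ {n} → ℕ → ℕ → Subset n → Adj n → Set
Elim k zero    S E = Empty S
Elim k (suc f) S E = Empty S ⊎ ∃ λ v → v ∈ S × ∣ nbhd S E v ∣ ≤ suc k × Elim k f (S - v) (fill v E)

elim? : ∀ {n} k f (S : Subset n) E → Dec (Elim k f S E)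
elim? k zero    S E = ¬? (nonempty? S)
elim? k (suc f) S E = ¬? (nonempty? S) ⊎-dec
  any? λ v → (v ∈? S) ×-dec ((∣ nbhd S E v ∣ ≤? suc k) ×-dec elim? k f (S - v) (fill v E))

-- Each of at most `f` eliminated vertices pays for its edges to the at most `k` neighbours still
-- present. Filling only adds edges, so a cover of the filled graph on `S - v` covers all old edges
-- avoiding `v`. The star lists `v` first, hence the two orientations.
elim⇒edge-cover : ∀ {n k} f {S : Subset n} {E} → Symmetric E → Elim k f S E →
  Σ (List (Fin n × Fin n)) λ l → length l ≤ f * k ×
    (∀ {x y} → x ∈ S → y ∈ S → x ≢ y → E x y ≡ true → (x , y) ∈ˡ l ⊎ (y , x) ∈ˡ l)
elim⇒edge-cover zero    _ S-empty = [] , z≤n , λ x∈S → contradiction (_ , x∈S) S-empty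
elim⇒edge-cover (suc f) _ (inj₁ S-empty) = [] , z≤n , λ x∈S → contradiction (_ , x∈S) S-empty
elim⇒edge-cover {n} {k} (suc f) {S} {E} E-sym (inj₂ (v , v∈S , deg , el))
  with l , len , cover ← elim⇒edge-cover f (fill-sym {v = v} {E} E-sym) el
  = star ++ l
  , (begin
      length (star ++ l)       ≡⟨ length-++ star ⟩
      length star + length l   ≡⟨ cong (_+ length l) (trans (length-map (v ,_) (elements N)) (length-elements N)) ⟩
      -- `N` omits `v`, which the closed neighbourhood counts: `suc k` drops to `k`.
      ∣ N ∣ + length l         ≤⟨ +-mono-≤ (≤-pred (≤-trans (x∈p⇒∣p-x∣<∣p∣ (∈-nbhd⁺ {E = E} v∈S (inj₁ refl))) deg)) len ⟩
      k + f * k                ∎)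
  , cover′
  where
  open ≤-Reasoning
  N = nbhd S E v - v
  star = map (v ,_) (elements N)
  ∈-star : ∀ {y} → y ∈ S → y ≢ v → E v y ≡ true → (v , y) ∈ˡ star
  ∈-star y∈S y≢v e = ∈-map⁺ (v ,_) (∈-elements (x∈p∧x≢y⇒x∈p-y (∈-nbhd⁺ {E = E} y∈S (inj₂ e)) y≢v))
  cover′ : ∀ {x y} → x ∈ S → y ∈ S → x ≢ y → E x y ≡ true → (x , y) ∈ˡ star ++ l ⊎ (y , x) ∈ˡ star ++ l
  cover′ {x} {y} x∈S y∈S x≢y e with x ≟ v | y ≟ v
  ... | yes refl | _        = inj₁ (∈-++⁺ˡ (∈-star y∈S (x≢y ∘ sym) e))
  ... | no _     | yes refl = inj₂ (∈-++⁺ˡ (∈-star x∈S x≢y (E-sym e)))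
  ... | no x≢v   | no y≢v
    with cover (x∈p∧x≢y⇒x∈p-y x∈S x≢v) (x∈p∧x≢y⇒x∈p-y y∈S y≢v) x≢y (∨-≡true⁺ (E x y) (inj₁ e))
  ... | inj₁ i = inj₁ (∈-++⁺ʳ star i)
  ... | inj₂ i = inj₂ (∈-++⁺ʳ star i)

-- Walks and trees

walk-map : ∀ {m m′} {R : Rel′ m} {R′ : Rel′ m′} (g : Fin m → Fin m′) → (∀ {a b} → R a b → R′ (g a) (g b)) →
           ∀ {a b xs} → Walk R a b xs → Walk R′ (g a) (g b) (map g xs)
walk-map g g-edge here     = here
walk-map g g-edge (e ∷ʷ w) = g-edge e ∷ʷ walk-map g g-edge w

start∈ : ∀ {m} {R : Rel′ m} {a b xs} → Walk R a b xs → a ∈ˡ xs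
start∈ here     = here refl
start∈ (e ∷ʷ w) = here refl

end∈ : ∀ {m} {R : Rel′ m} {a b xs} → Walk R a b xs → b ∈ˡ xs
end∈ here     = here refl
end∈ (e ∷ʷ w) = there (end∈ w)

connected-trans : ∀ {m} {R : Rel′ m} {P a b c} → ConnectedWithin R P a b → ConnectedWithin R P b c → ConnectedWithin R P a c
connected-trans (_ , here   , _)      q = q
connected-trans (_ , e ∷ʷ w , p ∷ ps) q with connected-trans (_ , w , ps) q
... | ys , w′ , ps′ = _ , e ∷ʷ w′ , p ∷ ps′

connected-sym : ∀ {m} {R : Rel′ m} {P} → (∀ {a b} → R a b → R b a) →
                ∀ {a b} → ConnectedWithin R P a b → ConnectedWithin R P b a
connected-sym R-sym (_ , here   , ps)     = _ , here , ps
connected-sym R-sym (_ , e ∷ʷ w , p ∷ ps) =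
  connected-trans (connected-sym R-sym (_ , w , ps))
                  (_ , R-sym e ∷ʷ here , All.lookup ps (start∈ w) ∷ p ∷ [])

∉⇒unique : ∀ {A : Set} {x : A} {xs} → x ∉ˡ xs → Unique xs → Unique (x ∷ xs)
∉⇒unique x∉xs u = ¬Any⇒All¬ _ x∉xs ∷ u

unique⇒∉ : ∀ {A : Set} {x : A} {xs} → Unique (x ∷ xs) → x ∉ˡ xs
unique⇒∉ (x∉ ∷ _) = All¬⇒¬Any x∉

-- The bound records that cutting a walk visits nothing new, so a vertex missing from the old walk
-- can be prepended without losing uniqueness.
Path : ∀ {m} → Rel′ m → Fin m → Fin m → List (Fin m) → Set
Path {m} R a b bound = Σ (List (Fin m)) λ ys → Walk R a b ys × Unique ys × ys ⊆ˡ bound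

walk-prefix : ∀ {m} {R : Rel′ m} {a b xs} → Walk R a b xs → Unique xs → ∀ {c} → c ∈ˡ xs → Path R a c xs
walk-prefix w        u       (here refl) = _ , subst (λ z → Walk _ z _ _) (head≡ w) here , [] ∷ [] , λ { (here refl) → here refl }
  where
  head≡ : ∀ {m} {R : Rel′ m} {a b x xs} → Walk R a b (x ∷ xs) → x ≡ a
  head≡ here     = refl
  head≡ (_ ∷ʷ _) = refl
walk-prefix (e ∷ʷ w) (x∉ ∷ u) (there c∈) with ys , w′ , u′ , ys⊆ ← walk-prefix w u c∈ =
  _ , e ∷ʷ w′ , ∉⇒unique (All¬⇒¬Any x∉ ∘ ys⊆) u′ , λ { (here refl) → here refl ; (there i) → there (ys⊆ i) }

walk-suffix : ∀ {m} {R : Rel′ m} {a b xs} → Walk R a b xs → Unique xs → ∀ {c} → c ∈ˡ xs → Path R c b xs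
walk-suffix here     u       (here refl) = _ , here , u , id
walk-suffix (e ∷ʷ w) u       (here refl) = _ , e ∷ʷ w , u , id
walk-suffix (e ∷ʷ w) (_ ∷ u) (there c∈)  with ys , w′ , u′ , ys⊆ ← walk-suffix w u c∈ =
  _ , w′ , u′ , there ∘ ys⊆

loop-erase : ∀ {m} {R : Rel′ m} {a b xs} → Walk R a b xs → Path R a b xs
loop-erase here = _ , here , [] ∷ [] , id
loop-erase {a = a} (e ∷ʷ w) with ys , w′ , u , ys⊆ ← loop-erase w with mem? _≟_ a ys
-- The walk returns to `a`: the loop before that visit is dropped.
... | yes a∈ys with zs , w″ , u″ , zs⊆ ← walk-suffix w′ u a∈ys = _ , w″ , u″ , there ∘ ys⊆ ∘ zs⊆
... | no  a∉ys = _ , e ∷ʷ w′ , ∉⇒unique a∉ys u , λ { (here refl) → here refl ; (there i) → there (ys⊆ i) }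

-- From elimination orders to tree decompositions, by attaching leaves

module _ {m : ℕ} (T : Rel′ m) (t₀ : Fin m) where

  attach : Rel′ (suc m)
  attach zero    zero    = Data.Empty.⊥
  attach zero    (suc t) = t ≡ t₀
  attach (suc s) zero    = s ≡ t₀
  attach (suc s) (suc t) = T s t

  attach-sym : (∀ {s t} → T s t → T t s) → ∀ {s t} → attach s t → attach t s
  attach-sym T-sym {zero}  {suc t} e = e
  attach-sym T-sym {suc s} {zero}  e = e
  attach-sym T-sym {suc s} {suc t} e = T-sym e

  -- The leaf joins the rest through `t₀`, so it suffices that `P` holds there whenever it holds at
  -- the leaf and at some old vertex. Arbitrary `P` serves both the connectedness of the tree and
  -- the coherence of the bags.
  attach-connected : ∀ {P : Fin (suc m) → Set} → (∀ {s t} → T s t → T t s) →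
    (∀ {s t} → P (suc s) → P (suc t) → ConnectedWithin T (P ∘ suc) s t) →
    (∀ {t} → P zero → P (suc t) → P (suc t₀)) →
    ∀ {s t} → P s → P t → ConnectedWithin attach P s t
  attach-connected {P} T-sym conn anchor {s} {t} = go s t
    where
    lift : ∀ {s t} → ConnectedWithin T (P ∘ suc) s t → ConnectedWithin attach P (suc s) (suc t)
    lift (xs , w , ps) = map suc xs , walk-map suc id w , All-map⁺ ps
    from-leaf : ∀ {t} → P zero → P (suc t) → ConnectedWithin attach P zero (suc t)
    from-leaf p q with xs , w , ps ← lift (conn (anchor p q) q) = zero ∷ xs , refl ∷ʷ w , p ∷ ps
    go : ∀ s t → P s → P t → ConnectedWithin attach P s t
    go zero    zero    p q = _ , here , p ∷ []
    go zero    (suc t) p q = from-leaf p q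
    go (suc s) zero    p q = connected-sym (λ {s} {t} → attach-sym T-sym {s} {t}) (from-leaf q p)
    go (suc s) (suc t) p q = lift (conn p q)

  -- Entering and leaving the leaf would visit `t₀` twice.
  unique-walk-avoids-leaf : ∀ {a b xs} → Walk attach (suc a) (suc b) xs → Unique xs →
                            Σ (List (Fin m)) λ ys → Walk T a b ys × xs ≡ map suc ys
  unique-walk-avoids-leaf here _ = _ , here , refl
  unique-walk-avoids-leaf (_∷ʷ_ {b = suc c} e w) (_ ∷ u) with ys , w′ , eq ← unique-walk-avoids-leaf w u =
    _ , e ∷ʷ w′ , cong (_ ∷_) eq
  unique-walk-avoids-leaf (_∷ʷ_ {b = zero} refl (_∷ʷ_ {b = suc _} refl w)) u =
    contradiction (there (start∈ w)) (unique⇒∉ u)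
  unique-walk-avoids-leaf (_∷ʷ_ {b = zero} refl (_∷ʷ_ {b = zero} () w)) u

  walk-to-leaf : ∀ {a xs} → Walk attach (suc a) zero xs → suc t₀ ∈ˡ xs
  walk-to-leaf (_∷ʷ_ {b = zero}  refl w) = here refl
  walk-to-leaf (_∷ʷ_ {b = suc _} e    w) = there (walk-to-leaf w)

  -- A cycle whose ends are old vertices lies in `T`. If one end is the leaf, the closing edge joins
  -- it to `t₀`, and having three vertices forces the walk to visit `t₀` or the leaf twice.
  attach-acyclic : ¬ HasCycle T → ¬ HasCycle attach
  attach-acyclic acyclic (suc a , suc b , xs , w , e , len , u) with unique-walk-avoids-leaf w u
  ... | ys , w′ , refl =
    acyclic (a , b , ys , w′ , e , subst (3 ≤_) (length-map suc ys) len , Unique-map⁻ u)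
  attach-acyclic _ (zero , suc b , _ , _∷ʷ_ {b = suc _} refl here , refl , s≤s (s≤s ()) , _)
  attach-acyclic _ (zero , suc b , _ , _∷ʷ_ {b = suc _} refl (_ ∷ʷ w) , refl , _ , _ ∷ u) =
    unique⇒∉ u (end∈ w)
  attach-acyclic _ (suc a , zero , _ , _∷ʷ_ {b = suc _} _ w , refl , _ , u) = unique⇒∉ u (walk-to-leaf w)
  attach-acyclic _ (suc a , zero , _ , _∷ʷ_ {b = zero} _ here , refl , s≤s (s≤s ()) , _)
  attach-acyclic _ (suc a , zero , _ , _∷ʷ_ {b = zero} _ (_ ∷ʷ w) , refl , _ , _ ∷ u) = unique⇒∉ u (end∈ w)

  attach-tree : IsTree m T → IsTree (suc m) attach
  attach-tree (_ , T-sym , T-irr , conn , acyclic) =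
    s≤s z≤n , (λ {s} {t} → attach-sym T-sym {s} {t}) , (λ { {suc t} → T-irr }) ,
    (λ _ _ → attach-connected T-sym (λ _ _ → conn _ _) _ tt tt) , attach-acyclic acyclic

-- Covering whole cliques, not just edges, is what lets the construction attach a new
-- bag to a bag containing the neighbourhood of the vertex that is put back.
record CliqueTree {n : ℕ} (k : ℕ) (S : Subset n) (E : Adj n) : Set₁ where
  field
    m        : ℕ
    T        : Rel′ m
    tree     : IsTree m T
    bag      : Fin m → Subset n
    bag⊆S    : ∀ t → bag t ⊆ S
    coherent : ∀ v t₁ t₂ → v ∈ bag t₁ → v ∈ bag t₂ → ConnectedWithin T (λ t → v ∈ bag t) t₁ t₂
    width    : ∀ t → ∣ bag t ∣ ≤ suc k
    clique   : ∀ K → K ⊆ S → (∀ {x y} → x ∈ K → y ∈ K → x ≢ y → E x y ≡ true) → ∃ λ t → K ⊆ bag t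

-- One empty bag instead of none: a tree is nonempty, and the empty clique needs a bag.
empty-cliqueTree : ∀ {n k} {S : Subset n} {E} → Empty S → CliqueTree k S E
empty-cliqueTree {n} S-empty = record
  { m = 1
  ; T = λ _ _ → Data.Empty.⊥
  ; tree = s≤s z≤n , (λ ()) , (λ ()) , (λ { zero zero → _ , here , tt ∷ [] }) , λ { (_ , _ , _ , _ , () , _) }
  ; bag = λ _ → ⊥
  ; bag⊆S = λ _ x∈ → contradiction x∈ ∉⊥
  ; coherent = λ _ _ _ v∈ → contradiction v∈ ∉⊥
  ; width = λ _ → ≤-trans (≤-reflexive (∣⊥∣≡0 n)) z≤n
  ; clique = λ K K⊆S _ → zero , λ x∈ → contradiction (_ , K⊆S x∈) S-empty
  }

-- Filling makes the neighbours of `v` a clique, so some bag contains them all. The closed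
-- neighbourhood of `v` becomes a leaf bag attached to it.
extend-cliqueTree : ∀ {n k} {S : Subset n} {E v} → Symmetric E → v ∈ S → ∣ nbhd S E v ∣ ≤ suc k →
                    CliqueTree k (S - v) (fill v E) → CliqueTree k S E
extend-cliqueTree {n} {k} {S} {E} {v} E-sym v∈S deg ct = record
  { m = suc m
  ; T = attach T t₀
  ; tree = attach-tree T t₀ tree
  ; bag = bag′
  ; bag⊆S = λ where
      zero    → proj₁ ∘ ∈-nbhd⁻ {E = E}
      (suc t) → p-x⊆p S v ∘ bag⊆S t
  ; coherent = λ x t₁ t₂ → attach-connected T t₀ {P = λ t → x ∈ bag′ t} (proj₁ (proj₂ tree))
      (coherent x _ _)
      -- Old bags lie in `S - v`, so a vertex shared with the new bag is a neighbour of `v` and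
      -- occurs in the anchor bag.
      (λ x∈N x∈ → N⊆bag (x∈p∧x≢y⇒x∈p-y x∈N (x∈p-y⇒x≢y {p = S} (bag⊆S _ x∈))))
  ; width = λ { zero → deg ; (suc t) → width t }
  ; clique = clique′
  }
  where
  open CliqueTree ct
  neighbour : ∀ {x} → x ∈ nbhd S E v - v → E v x ≡ true
  neighbour x∈ with ∈-nbhd⁻ {S = S} {E = E} (p-x⊆p (nbhd S E v) v x∈)
  ... | _ , inj₁ x≡v = contradiction x≡v (x∈p-y⇒x≢y {p = nbhd S E v} x∈)
  ... | _ , inj₂ e   = e
  anchor : ∃ λ t → nbhd S E v - v ⊆ bag t
  anchor = clique (nbhd S E v - v)
    (λ x∈ → x∈p∧x≢y⇒x∈p-y (proj₁ (∈-nbhd⁻ {E = E} (p-x⊆p (nbhd S E v) v x∈))) (x∈p-y⇒x≢y {p = nbhd S E v} x∈))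
    (λ {x} {y} x∈ y∈ _ → ∨-≡true⁺ (E x y) (inj₂ (∧-≡true⁺ (E-sym (neighbour x∈)) (neighbour y∈))))
  t₀ = proj₁ anchor
  N⊆bag : nbhd S E v - v ⊆ bag t₀
  N⊆bag = proj₂ anchor
  bag′ : Fin (suc m) → Subset n
  bag′ zero    = nbhd S E v
  bag′ (suc t) = bag t
  clique′ : ∀ K → K ⊆ S → (∀ {x y} → x ∈ K → y ∈ K → x ≢ y → E x y ≡ true) → ∃ λ t → K ⊆ bag′ t
  -- A clique through `v` lies in the closed neighbourhood of `v`; any other one is still a clique
  -- in the filled graph on `S - v`.
  clique′ K K⊆S K-clique with v ∈? K
  ... | yes v∈K = zero , in-nbhd
    where
    in-nbhd : K ⊆ nbhd S E v
    in-nbhd {x} x∈ with x ≟ v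
    ... | yes x≡v = ∈-nbhd⁺ {E = E} (K⊆S x∈) (inj₁ x≡v)
    ... | no x≢v  = ∈-nbhd⁺ {E = E} (K⊆S x∈) (inj₂ (K-clique v∈K x∈ (x≢v ∘ sym)))
  ... | no v∉K with t , K⊆ ← clique K
                   (λ x∈ → x∈p∧x≢y⇒x∈p-y (K⊆S x∈) λ { refl → v∉K x∈ })
                   (λ {x} {y} x∈ y∈ x≢y → ∨-≡true⁺ (E x y) (inj₁ (K-clique x∈ y∈ x≢y)))
              = suc t , K⊆

elim⇒cliqueTree : ∀ {n k} f {S : Subset n} {E} → Symmetric E → Elim k f S E → CliqueTree k S E
elim⇒cliqueTree zero    E-sym S-empty        = empty-cliqueTree S-empty
elim⇒cliqueTree (suc f) E-sym (inj₁ S-empty) = empty-cliqueTree S-empty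
elim⇒cliqueTree (suc f) {E = E} E-sym (inj₂ (v , v∈S , deg , el)) =
  extend-cliqueTree {E = E} E-sym v∈S deg (elim⇒cliqueTree f (fill-sym {v = v} {E} E-sym) el)

-- Edges and single vertices are cliques of at most two elements. A vertex is treated as the pair of
-- `v` with itself, for which the adjacency demand is vacuous.
elim⇒treewidth : ∀ {n k} f {E : Adj n} → Symmetric E → Elim k f ⊤ E → TreewidthAtMost k (λ x y → E x y ≡ true)
elim⇒treewidth {n} f {E} E-sym el = record
  { m = m ; T = T ; tree = tree ; bag = bag
  ; vertexCov = λ v → let t , ⊆bag = pair v v (λ v≢v → contradiction refl v≢v) in t , proj₁ ⊆bag
  ; edgeCov = λ u v e → pair u v λ _ → e
  ; coherent = coherent
  ; width≤k = width
  }
  where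
  open CliqueTree (elim⇒cliqueTree f {E = E} E-sym el)
  pair : ∀ u v → (u ≢ v → E u v ≡ true) → ∃ λ t → u ∈ bag t × v ∈ bag t
  pair u v e with clique (⁅ u ⁆ ∪ ⁅ v ⁆) (λ _ → ∈⊤) K-clique
    where
    K-clique : ∀ {x y} → x ∈ ⁅ u ⁆ ∪ ⁅ v ⁆ → y ∈ ⁅ u ⁆ ∪ ⁅ v ⁆ → x ≢ y → E x y ≡ true
    K-clique x∈ y∈ x≢y with x∈p∪q⁻ ⁅ u ⁆ ⁅ v ⁆ x∈ | x∈p∪q⁻ ⁅ u ⁆ ⁅ v ⁆ y∈
    ... | inj₁ x∈u | inj₁ y∈u = contradiction (trans (x∈⁅y⁆⇒x≡y u x∈u) (sym (x∈⁅y⁆⇒x≡y u y∈u))) x≢y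
    ... | inj₂ x∈v | inj₂ y∈v = contradiction (trans (x∈⁅y⁆⇒x≡y v x∈v) (sym (x∈⁅y⁆⇒x≡y v y∈v))) x≢y
    ... | inj₁ x∈u | inj₂ y∈v with refl ← x∈⁅y⁆⇒x≡y u x∈u | refl ← x∈⁅y⁆⇒x≡y v y∈v = e x≢y
    ... | inj₂ x∈v | inj₁ y∈u with refl ← x∈⁅y⁆⇒x≡y v x∈v | refl ← x∈⁅y⁆⇒x≡y u y∈u = E-sym (e (x≢y ∘ sym))
  ... | t , K⊆ = t , K⊆ (x∈p∪q⁺ (inj₁ (x∈⁅x⁆ u))) , K⊆ (x∈p∪q⁺ (inj₂ (x∈⁅x⁆ v)))

-- Leaves of trees, and from tree decompositions to elimination orders

module TreeLaws {m : ℕ} {T : Rel′ m} (tree : IsTree m T) where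

  T-sym : ∀ {s t} → T s t → T t s
  T-sym = proj₁ (proj₂ tree)

  T-irr : ∀ {t} → ¬ T t t
  T-irr = proj₁ (proj₂ (proj₂ tree))

  conn : Connected T
  conn = proj₁ (proj₂ (proj₂ (proj₂ tree)))

  acyclic : ¬ HasCycle T
  acyclic = proj₂ (proj₂ (proj₂ (proj₂ tree)))

module _ {m : ℕ} {T : Rel′ m} (tree : IsTree m T) where
  open TreeLaws tree

  -- `T` comes without a decision procedure, but a simple path from `s` to `t` decides it: a single
  -- step is the edge, and an edge besides a longer path would close a cycle.
  tree-edge? : ∀ s t → Dec (T s t)
  tree-edge? s t with conn s t
  ... | _ , w , _ with loop-erase w
  ... | _ , here , _ = no T-irr
  ... | _ , e ∷ʷ here , _ = yes e
  ... | _ , e ∷ʷ (e′ ∷ʷ w′) , u , _ = no λ st →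
    acyclic (s , t , _ , e ∷ʷ (e′ ∷ʷ w′) , T-sym st , s≤s (s≤s (nonempty w′)) , u)
    where
    nonempty : ∀ {a b xs} → Walk T a b xs → 1 ≤ length xs
    nonempty here     = s≤s z≤n
    nonempty (_ ∷ʷ _) = s≤s z≤n

  IsLeaf : Fin m → Fin m → Set
  IsLeaf t s = T t s × (∀ {u} → T t u → u ≡ s)

  -- A neighbour of `t` further along the path would close a cycle with the part of the path leading
  -- to it.
  stuck⇒leaf : ∀ {t s r xs} (e : T t s) → Walk T s r xs → Unique (t ∷ xs) →
               (∀ {u} → T t u → u ∈ˡ t ∷ xs) → IsLeaf t s
  stuck⇒leaf {t} {s} e w (t∉ ∷ u) stuck = e , unique-neighbour
    where
    length≥2 : ∀ {a b xs} → a ≢ b → Walk T a b xs → 2 ≤ length xs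
    length≥2 a≢b here            = contradiction refl a≢b
    length≥2 a≢b (_ ∷ʷ here)     = s≤s (s≤s z≤n)
    length≥2 a≢b (_ ∷ʷ (_ ∷ʷ _)) = s≤s (s≤s z≤n)
    unique-neighbour : ∀ {v} → T t v → v ≡ s
    unique-neighbour {v} tv with v ≟ s | stuck tv
    ... | yes v≡s | _         = v≡s
    ... | no _    | here refl = contradiction tv T-irr
    ... | no v≢s  | there v∈ with ys , w′ , u′ , ys⊆ ← walk-prefix w u v∈ =
      contradiction (t , v , _ , e ∷ʷ w′ , T-sym tv , s≤s (length≥2 (v≢s ∘ sym) w′) ,
                     ∉⇒unique (All¬⇒¬Any t∉ ∘ ys⊆) u′) acyclic

  -- Extends a simple path at its front until it is stuck. `U` contains all unvisited vertices and
  -- loses one at each extension, so `f` bounds their number.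
  grow-path : ∀ f (U : Subset m) → ∣ U ∣ ≤ f → ∀ {t s r xs} (e : T t s) → Walk T s r xs → Unique (t ∷ xs) →
              (∀ {u} → u ∉ˡ t ∷ xs → u ∈ U) → ∃ λ t → ∃ λ s → IsLeaf t s
  grow-path f U ∣U∣≤f {t} {s} {xs = xs} e w u unvisited
    with any? (λ v → tree-edge? t v ×-dec ¬? (mem? _≟_ v (t ∷ xs)))
  ... | no stuck = t , s , stuck⇒leaf e w u λ {v} tv →
          decidable-stable (mem? _≟_ v (t ∷ xs)) λ v∉ → stuck (v , tv , v∉)
  grow-path zero    U ∣U∣≤f e w u unvisited | yes (v , tv , v∉) =
    contradiction (≤-trans (x∈p⇒∣p-x∣<∣p∣ (unvisited v∉)) ∣U∣≤f) λ ()
  grow-path (suc f) U ∣U∣≤f e w u unvisited | yes (v , tv , v∉) =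
    grow-path f (U - v) (≤-pred (≤-trans (x∈p⇒∣p-x∣<∣p∣ (unvisited v∉)) ∣U∣≤f))
      (T-sym tv) (e ∷ʷ w) (∉⇒unique v∉ u)
      λ x∉ → x∈p∧x≢y⇒x∈p-y (unvisited (x∉ ∘ there)) (x∉ ∘ here)

  leaf : ∀ {a b : Fin m} → a ≢ b → ∃ λ t → ∃ λ s → IsLeaf t s
  leaf {a} {b} a≢b with conn a b
  ... | _ , here   , _ = contradiction refl a≢b
  ... | _ , _∷ʷ_ {b = c} e _ , _ = grow-path ∣ ⊤ {m} ∣ ⊤ ≤-refl e here
    (∉⇒unique (λ { (here refl) → T-irr e }) ([] ∷ [])) (λ _ → ∈⊤)

module _ {m : ℕ} {T : Rel′ (suc m)} (tree : IsTree (suc m) T) {t s : Fin (suc m)} (t-leaf : IsLeaf tree t s) where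
  open TreeLaws tree

  private
    only-s : ∀ {u} → T t u → u ≡ s
    only-s = proj₂ t-leaf

    t≢s : t ≢ s
    t≢s refl = T-irr (proj₁ t-leaf)

  prune : Rel′ m
  prune i j = T (punchIn t i) (punchIn t j)

  -- Sends the leaf to its neighbour, so that walks survive the deletion of the leaf.
  retract : Fin (suc m) → Fin m
  retract x with t ≟ x
  ... | yes _  = punchOut t≢s
  ... | no t≢x = punchOut t≢x

  retract-punchIn : ∀ i → retract (punchIn t i) ≡ i
  retract-punchIn i with t ≟ punchIn t i
  ... | yes t≡  = contradiction (sym t≡) (punchInᵢ≢i t i)
  ... | no t≢   = trans (punchOut-cong t refl) (punchOut-punchIn t)

  retract-leaf : retract t ≡ retract s
  retract-leaf with t ≟ t | t ≟ s
  ... | _      | yes t≡s = contradiction t≡s t≢s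
  ... | yes _  | no _    = punchOut-cong t refl
  ... | no t≢t | no _    = contradiction refl t≢t

  retract-preserves : ∀ {P : Fin (suc m) → Set} → (P t → P s) → ∀ {x} → P x → P (punchIn t (retract x))
  retract-preserves {P} Pt⇒Ps {x} p with t ≟ x
  ... | yes refl = subst P (sym (punchIn-punchOut t≢s)) (Pt⇒Ps p)
  ... | no t≢x   = subst P (sym (punchIn-punchOut t≢x)) p

  punchIn-retract : ∀ {x} → t ≢ x → punchIn t (retract x) ≡ x
  punchIn-retract {x} t≢x with t ≟ x
  ... | yes t≡x = contradiction t≡x t≢x
  ... | no t≢x′ = punchIn-punchOut t≢x′

  retract-edge : ∀ {x y} → T x y → retract x ≡ retract y ⊎ prune (retract x) (retract y)
  retract-edge {x} {y} e = go (t ≟ x) (t ≟ y)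
    where
    go : Dec (t ≡ x) → Dec (t ≡ y) → retract x ≡ retract y ⊎ prune (retract x) (retract y)
    go (yes refl) _          = inj₁ (trans retract-leaf (cong retract (sym (only-s e))))
    go (no _)     (yes refl) = inj₁ (trans (cong retract (only-s (T-sym e))) (sym retract-leaf))
    go (no t≢x)   (no t≢y)   = inj₂ (subst₂ T (sym (punchIn-retract t≢x)) (sym (punchIn-retract t≢y)) e)

  -- The image of a walk is a walk, with the steps at the leaf collapsed; visits to the leaf become
  -- visits to `s`, where `P` is inherited.
  retract-connected : ∀ {P : Fin (suc m) → Set} → (P t → P s) → ∀ {a b} → ConnectedWithin T P a b →
                      ConnectedWithin prune (P ∘ punchIn t) (retract a) (retract b)
  retract-connected {P} Pt⇒Ps (_ , here   , p ∷ []) = _ , here , retract-preserves {P} Pt⇒Ps p ∷ []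
  retract-connected {P} Pt⇒Ps (_ , e ∷ʷ w , p ∷ ps) with retract-connected Pt⇒Ps (_ , w , ps) | retract-edge e
  ... | rest         | inj₁ eq = subst (λ z → ConnectedWithin prune (P ∘ punchIn t) z _) (sym eq) rest
  ... | _ , w′ , ps′ | inj₂ e′ = _ , e′ ∷ʷ w′ , retract-preserves {P} Pt⇒Ps p ∷ ps′

  prune-connected : ∀ {P : Fin (suc m) → Set} → (P t → P s) → ∀ {i j} →
                    ConnectedWithin T P (punchIn t i) (punchIn t j) → ConnectedWithin prune (P ∘ punchIn t) i j
  prune-connected {P} Pt⇒Ps {i} {j} c = subst₂ (ConnectedWithin prune (P ∘ punchIn t))
    (retract-punchIn i) (retract-punchIn j) (retract-connected Pt⇒Ps c)

  prune-tree : IsTree m prune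
  prune-tree =
    0<m (retract s) , T-sym , T-irr , (λ i j → prune-connected id (conn _ _)) ,
    λ (a , b , xs , w , e , len , u) → acyclic
      ( punchIn t a , punchIn t b , map (punchIn t) xs , walk-map (punchIn t) id w , e
      , subst (3 ≤_) (sym (length-map (punchIn t) xs)) len
      , Unique-map⁺ (punchIn-injective t _ _) u )
    where
    0<m : ∀ {m} → Fin m → 0 < m
    0<m {suc _} _ = s≤s z≤n

-- Tree decompositions of the subgraph induced by S; bags may contain vertices outside S.
record Decomposition {n : ℕ} (k m : ℕ) (S : Subset n) (E : Adj n) : Set₁ where
  field
    T         : Rel′ m
    tree      : IsTree m T
    bag       : Fin m → Subset n
    vertexCov : ∀ {v} → v ∈ S → ∃ λ t → v ∈ bag t
    edgeCov   : ∀ {u v} → u ∈ S → v ∈ S → E u v ≡ true → ∃ λ t → u ∈ bag t × v ∈ bag t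
    coherent  : ∀ {v} t₁ t₂ → v ∈ S → v ∈ bag t₁ → v ∈ bag t₂ → ConnectedWithin T (λ t → v ∈ bag t) t₁ t₂
    width     : ∀ t → ∣ bag t ∣ ≤ suc k

module _ {n k m : ℕ} {S : Subset n} {E : Adj n} (d : Decomposition k m S E) where
  open Decomposition d

  -- A vertex occurring in no bag but that of t can be eliminated without changing the bags.
  Private : Fin n → Fin m → Set
  Private v t = ∀ {t′} → v ∈ bag t′ → t′ ≡ t

  -- Each edge at `v` is covered by a bag containing `v`, and `bag t` is the only one, so it
  -- contains the closed neighbourhood.
  private-nbhd : ∀ {v t} → v ∈ S → Private v t → ∣ nbhd S E v ∣ ≤ suc k
  private-nbhd {v} {t} v∈S only-t = ≤-trans (p⊆q⇒∣p∣≤∣q∣ nbhd⊆bag) (width t)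
    where
    nbhd⊆bag : nbhd S E v ⊆ bag t
    nbhd⊆bag x∈ with ∈-nbhd⁻ {S = S} {E} x∈
    ... | x∈S , inj₁ refl with t′ , x∈bag ← vertexCov x∈S with refl ← only-t x∈bag = x∈bag
    ... | x∈S , inj₂ e with t′ , v∈bag , x∈bag ← edgeCov v∈S x∈S e with refl ← only-t v∈bag = x∈bag

  -- Both halves of a path through `v` are covered by `bag t`, which therefore covers the fill edge
  -- as well.
  eliminate-private : ∀ {v t} → v ∈ S → Private v t → Decomposition k m (S - v) (fill v E)
  eliminate-private {v} {t} v∈S only-t = record
    { T = T ; tree = tree ; bag = bag
    ; vertexCov = vertexCov ∘ p-x⊆p S v
    ; edgeCov = λ x∈ y∈ → edgeCov′ (p-x⊆p S v x∈) (p-x⊆p S v y∈)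
    ; coherent = λ t₁ t₂ → coherent t₁ t₂ ∘ p-x⊆p S v
    ; width = width
    }
    where
    edgeCov′ : ∀ {x y} → x ∈ S → y ∈ S → fill v E x y ≡ true → ∃ λ t → x ∈ bag t × y ∈ bag t
    edgeCov′ {x} {y} x∈S y∈S e with ∨-≡true⁻ (E x y) e
    ... | inj₁ xy = edgeCov x∈S y∈S xy
    ... | inj₂ xvy
      with xv , vy ← ∧-≡true⁻ (E x v) xvy
      with _ , x∈bag , v∈bag ← edgeCov x∈S v∈S xv | _ , v∈bag′ , y∈bag ← edgeCov v∈S y∈S vy
      with refl ← only-t v∈bag | refl ← only-t v∈bag′
      = t , x∈bag , y∈bag

-- Within `S` the leaf bag is contained in the bag of its neighbour, so whatever it covered is
-- covered after `retract`.
prune-decomposition : ∀ {n k m} {S : Subset n} {E} (d : Decomposition k (suc m) S E) →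
  let open Decomposition d in
  ∀ {t s} → IsLeaf tree t s → (∀ {v} → v ∈ S → v ∈ bag t → v ∈ bag s) → Decomposition k m S E
prune-decomposition {S = S} d {t} {s} leaf t⊆s = record
  { T = prune tree leaf
  ; tree = prune-tree tree leaf
  ; bag = bag ∘ punchIn t
  ; vertexCov = λ v∈S → let t′ , v∈ = vertexCov v∈S in _ , move v∈S v∈
  ; edgeCov = λ u∈S v∈S e → let t′ , u∈ , v∈ = edgeCov u∈S v∈S e in _ , move u∈S u∈ , move v∈S v∈
  ; coherent = λ t₁ t₂ v∈S v∈₁ v∈₂ → prune-connected tree leaf (t⊆s v∈S) (coherent _ _ v∈S v∈₁ v∈₂)
  ; width = width ∘ punchIn t
  }
  where
  open Decomposition d
  move : ∀ {v x} → v ∈ S → v ∈ bag x → v ∈ bag (punchIn t (retract tree leaf x))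
  move {v} v∈S = retract-preserves tree leaf {λ x → v ∈ bag x} (t⊆s v∈S)

-- Take a leaf bag. If a vertex of `S` in it is missing from the neighbouring bag, that vertex is
-- private and can be eliminated, which lowers `f`. Otherwise the leaf can be pruned, which lowers
-- `m`.
decomposition⇒elim : ∀ {n k} m f {S : Subset n} {E} → Decomposition k m S E → ∣ S ∣ ≤ f → Elim k f S E
decomposition⇒elim m zero {S} d ∣S∣≤0 (v , v∈S) = contradiction (≤-trans (x∈p⇒∣p-x∣<∣p∣ v∈S) ∣S∣≤0) λ ()
decomposition⇒elim zero (suc f) d _ with () , _ ← Decomposition.tree d
decomposition⇒elim {n} {k} (suc m) (suc f) {S} {E} d ∣S∣≤1+f = go m d (decomposition⇒elim m (suc f))
  where
  shrink : ∀ {v} → v ∈ S → ∣ S - v ∣ ≤ f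
  shrink v∈S = ≤-pred (≤-trans (x∈p⇒∣p-x∣<∣p∣ v∈S) ∣S∣≤1+f)
  -- The second argument after `m` is the induction hypothesis for one bag fewer, fixed before `m`
  -- is split into cases.
  go : ∀ m → Decomposition k (suc m) S E → (Decomposition k m S E → ∣ S ∣ ≤ suc f → Elim k (suc f) S E) →
       Elim k (suc f) S E
  go zero d _ with nonempty? S
  ... | no  S-empty    = inj₁ S-empty
  ... | yes (v , v∈S) = inj₂ (v , v∈S , private-nbhd d v∈S only-zero ,
          decomposition⇒elim 1 f (eliminate-private d v∈S only-zero) (shrink v∈S))
    where
    only-zero : Private d v zero
    only-zero {zero} _ = refl
  go (suc m) d rec
    with t , s , leaf@(_ , only-s) ← leaf (Decomposition.tree d) {zero} {suc zero} (λ ())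
    with any? (λ v → (v ∈? S) ×-dec ((v ∈? Decomposition.bag d t) ×-dec ¬? (v ∈? Decomposition.bag d s)))
  ... | yes (v , v∈S , v∈t , v∉s) = inj₂ (v , v∈S , private-nbhd d v∈S only-t ,
          decomposition⇒elim (suc (suc m)) f (eliminate-private d v∈S only-t) (shrink v∈S))
    where
    open Decomposition d
    only-t : Private d v t
    -- A walk from `t` to another bag of `v` would first step to `s`, whose bag omits `v`.
    only-t {t′} v∈t′ with coherent t t′ v∈S v∈t v∈t′
    ... | _ , here   , _ = refl
    ... | _ , e ∷ʷ w , _ ∷ ps with refl ← only-s e = contradiction (All.lookup ps (start∈ w)) v∉s
  ... | no none = rec (prune-decomposition d leaf λ {v} v∈S v∈t →
          decidable-stable (v ∈? Decomposition.bag d s) λ v∉s → none (v , v∈S , v∈t , v∉s)) ∣S∣≤1+f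

treewidth⇒elim : ∀ {n k} {E : Adj n} → TreewidthAtMost k (λ x y → E x y ≡ true) → Elim k n ⊤ E
treewidth⇒elim {n} td = decomposition⇒elim m n
  record
    { T = T ; tree = tree ; bag = bag
    ; vertexCov = λ {v} _ → vertexCov v
    ; edgeCov = λ {u} {v} _ _ → edgeCov u v
    ; coherent = λ {v} t₁ t₂ _ → coherent v t₁ t₂
    ; width = width≤k
    }
  (≤-reflexive (∣⊤∣≡n n))
  where open TreeDecomposition td

-- Sketches

-- Strong induction: `n` is at most twice its upper half, whose logarithm is smaller by one.
n≤2^⌈log₂n⌉ : ∀ n → n ≤ 2 ^ ⌈log₂ n ⌉
n≤2^⌈log₂n⌉ = <-rec _ λ where
    zero          _   → z≤n
    (suc zero)    _   → s≤s z≤n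
    (suc (suc n)) rec → halve n (rec (⌈n/2⌉<n n))
  where
  open ≤-Reasoning
  halve : ∀ n → ⌈ suc (suc n) /2⌉ ≤ 2 ^ ⌈log₂ ⌈ suc (suc n) /2⌉ ⌉ →
          suc (suc n) ≤ 2 ^ ⌈log₂ suc (suc n) ⌉
  halve n ih = begin
    N                            ≡⟨ ⌊n/2⌋+⌈n/2⌉≡n N ⟨
    ⌊ N /2⌋ + ⌈ N /2⌉            ≤⟨ +-monoˡ-≤ _ (⌊n/2⌋≤⌈n/2⌉ N) ⟩
    ⌈ N /2⌉ + ⌈ N /2⌉            ≤⟨ +-mono-≤ ih ih ⟩
    2 ^ l + 2 ^ l                ≡⟨ cong (2 ^ l +_) (+-identityʳ (2 ^ l)) ⟨
    2 ^ suc l                    ≡⟨ cong (λ x → 2 ^ suc x) (⌈log₂⌈n/2⌉⌉≡⌈log₂n⌉∸1 N) ⟩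
    2 ^ (1 + (⌈log₂ N ⌉ ∸ 1))    ≡⟨ cong (2 ^_) (m+[n∸m]≡n (⌈log₂⌉-mono-≤ {2} {N} (s≤s (s≤s z≤n)))) ⟩
    2 ^ ⌈log₂ N ⌉                ∎
    where
    N = suc (suc n)
    l = ⌈log₂ ⌈ N /2⌉ ⌉

n<2^word : ∀ n → n < 2 ^ word n
n<2^word n = begin-strict
  n                ≤⟨ n≤2^⌈log₂n⌉ n ⟩
  2 ^ ⌈log₂ n ⌉    <⟨ ^-monoʳ-< 2 (s≤s (s≤s z≤n)) (m<m+n ⌈log₂ n ⌉ (s≤s z≤n)) ⟩
  2 ^ word n       ∎
  where open ≤-Reasoning

n*n<2^2word : ∀ n → n * n < 2 ^ (2 * word n)
n*n<2^2word n = begin-strict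
  n * n                    <⟨ *-mono-< (n<2^word n) (n<2^word n) ⟩
  2 ^ word n * 2 ^ word n  ≡⟨ ^-distribˡ-+-* 2 (word n) (word n) ⟨
  2 ^ (word n + word n)    ≡⟨ cong (λ x → 2 ^ (word n + x)) (+-identityʳ (word n)) ⟨
  2 ^ (2 * word n)         ∎
  where open ≤-Reasoning

toBits : ∀ c → ℕ → Vec Bool c
toBits zero    x = []
toBits (suc c) x with x <? 2 ^ c
... | yes _ = false ∷ toBits c x
... | no  _ = true ∷ toBits c (x ∸ 2 ^ c)

fromBits : ∀ {c} → Vec Bool c → ℕ
fromBits         []          = 0
fromBits         (false ∷ v) = fromBits v
fromBits {suc c} (true ∷ v)  = 2 ^ c + fromBits v

fromBits-toBits : ∀ c {x} → x < 2 ^ c → fromBits (toBits c x) ≡ x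
fromBits-toBits zero    {zero}  _ = refl
fromBits-toBits zero    {suc x} (s≤s ())
fromBits-toBits (suc c) {x} x<2^1+c with x <? 2 ^ c
... | yes x<2^c = fromBits-toBits c x<2^c
... | no  x≮2^c = begin
  2 ^ c + fromBits (toBits c (x ∸ 2 ^ c))  ≡⟨ cong (2 ^ c +_) (fromBits-toBits c x∸2^c<2^c) ⟩
  2 ^ c + (x ∸ 2 ^ c)                      ≡⟨ m+[n∸m]≡n (≮⇒≥ x≮2^c) ⟩
  x                                        ∎
  where
  open ≡-Reasoning
  x∸2^c<2^c : x ∸ 2 ^ c < 2 ^ c
  x∸2^c<2^c = m<n+o⇒m∸n<o x (2 ^ c) {{m^n≢0 2 c}} (subst (λ y → x < 2 ^ c + y) (+-identityʳ (2 ^ c)) x<2^1+c)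

-- XOR vectors and linear sketches

infixl 6 _⊕_

_⊕_ : ∀ {r} → Vec Bool r → Vec Bool r → Vec Bool r
_⊕_ = zipWith _xor_

𝟘 : ∀ {r} → Vec Bool r
𝟘 = replicate _ false

⊕-assoc : ∀ {r} (x y z : Vec Bool r) → (x ⊕ y) ⊕ z ≡ x ⊕ (y ⊕ z)
⊕-assoc = zipWith-assoc xor-assoc

⊕-comm : ∀ {r} (x y : Vec Bool r) → x ⊕ y ≡ y ⊕ x
⊕-comm = zipWith-comm xor-comm

⊕-identityˡ : ∀ {r} (x : Vec Bool r) → 𝟘 ⊕ x ≡ x
⊕-identityˡ = zipWith-identityˡ xor-identityˡ

⊕-same : ∀ {r} (x : Vec Bool r) → x ⊕ x ≡ 𝟘
⊕-same []      = refl
⊕-same (b ∷ x) = cong₂ _∷_ (xor-same b) (⊕-same x)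

⊕-cancelˡ : ∀ {r} (x y : Vec Bool r) → x ⊕ (x ⊕ y) ≡ y
⊕-cancelˡ x y = trans (sym (⊕-assoc x x y)) (trans (cong (_⊕ y) (⊕-same x)) (⊕-identityˡ y))

x⊕y≡𝟘⇒x≡y : ∀ {r} (x y : Vec Bool r) → x ⊕ y ≡ 𝟘 → x ≡ y
x⊕y≡𝟘⇒x≡y x y eq = begin
  x            ≡⟨ ⊕-cancelˡ y x ⟨
  y ⊕ (y ⊕ x)  ≡⟨ cong (y ⊕_) (trans (⊕-comm y x) eq) ⟩
  y ⊕ 𝟘        ≡⟨ ⊕-comm y 𝟘 ⟩
  𝟘 ⊕ y        ≡⟨ ⊕-identityˡ y ⟩
  y            ∎
  where open ≡-Reasoning

-- On subsets `⊕` is the symmetric difference: common elements cancel.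
∣p⊕q∣≤∣p∣+∣q∣ : ∀ {N} (p q : Subset N) → ∣ p ⊕ q ∣ ≤ ∣ p ∣ + ∣ q ∣
∣p⊕q∣≤∣p∣+∣q∣ []          []          = z≤n
∣p⊕q∣≤∣p∣+∣q∣ (false ∷ p) (false ∷ q) = ∣p⊕q∣≤∣p∣+∣q∣ p q
∣p⊕q∣≤∣p∣+∣q∣ (false ∷ p) (true  ∷ q) = ≤-trans (s≤s (∣p⊕q∣≤∣p∣+∣q∣ p q)) (≤-reflexive (sym (+-suc ∣ p ∣ ∣ q ∣)))
∣p⊕q∣≤∣p∣+∣q∣ (true  ∷ p) (false ∷ q) = s≤s (∣p⊕q∣≤∣p∣+∣q∣ p q)
∣p⊕q∣≤∣p∣+∣q∣ (true  ∷ p) (true  ∷ q) = ≤-trans (∣p⊕q∣≤∣p∣+∣q∣ p q) (+-mono-≤ (n≤1+n ∣ p ∣) (n≤1+n ∣ q ∣))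

-- The syndrome of the characteristic vector of the subset, with `hs` as the columns of a
-- parity-check matrix.
sketch : ∀ {r N} → Vec (Vec Bool r) N → Subset N → Vec Bool r
sketch []       []          = 𝟘
sketch (h ∷ hs) (true  ∷ p) = h ⊕ sketch hs p
sketch (h ∷ hs) (false ∷ p) = sketch hs p

sketch-⊥ : ∀ {r N} (hs : Vec (Vec Bool r) N) → sketch hs ⊥ ≡ 𝟘
sketch-⊥ []       = refl
sketch-⊥ (h ∷ hs) = sketch-⊥ hs

sketch-⊕ : ∀ {r N} (hs : Vec (Vec Bool r) N) p q → sketch hs (p ⊕ q) ≡ sketch hs p ⊕ sketch hs q
sketch-⊕ []       []          []          = sym (⊕-identityˡ 𝟘)
sketch-⊕ (h ∷ hs) (false ∷ p) (false ∷ q) = sketch-⊕ hs p q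
sketch-⊕ (h ∷ hs) (true  ∷ p) (false ∷ q) =
  trans (cong (h ⊕_) (sketch-⊕ hs p q)) (sym (⊕-assoc h (sketch hs p) (sketch hs q)))
sketch-⊕ (h ∷ hs) (false ∷ p) (true  ∷ q) = begin
  h ⊕ sketch hs (p ⊕ q)    ≡⟨ cong (h ⊕_) (trans (sketch-⊕ hs p q) (⊕-comm P Q)) ⟩
  h ⊕ (Q ⊕ P)              ≡⟨ ⊕-assoc h Q P ⟨
  (h ⊕ Q) ⊕ P              ≡⟨ ⊕-comm (h ⊕ Q) P ⟩
  P ⊕ (h ⊕ Q)              ∎
  where
  open ≡-Reasoning
  P = sketch hs p
  Q = sketch hs q
sketch-⊕ (h ∷ hs) (true  ∷ p) (true  ∷ q) = begin
  sketch hs (p ⊕ q)        ≡⟨ sketch-⊕ hs p q ⟩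
  P ⊕ Q                    ≡⟨ cong (_⊕ Q) (⊕-cancelˡ h P) ⟨
  (h ⊕ (h ⊕ P)) ⊕ Q        ≡⟨ cong (_⊕ Q) (⊕-comm h (h ⊕ P)) ⟩
  ((h ⊕ P) ⊕ h) ⊕ Q        ≡⟨ ⊕-assoc (h ⊕ P) h Q ⟩
  (h ⊕ P) ⊕ (h ⊕ Q)        ∎
  where
  open ≡-Reasoning
  P = sketch hs p
  Q = sketch hs q

-- Insertion and deletion coincide over the two-element field, so adding one column serves both.
sketch-flip : ∀ {r N} (hs : Vec (Vec Bool r) N) p e →
              sketch hs (updateAt p e not) ≡ lookup hs e ⊕ sketch hs p
sketch-flip (h ∷ hs) (false ∷ p) zero    = refl
sketch-flip (h ∷ hs) (true  ∷ p) zero    = sym (⊕-cancelˡ h (sketch hs p))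
sketch-flip (h ∷ hs) (false ∷ p) (suc e) = sketch-flip hs p e
sketch-flip (h ∷ hs) (true  ∷ p) (suc e) = begin
  h ⊕ sketch hs (updateAt p e not)   ≡⟨ cong (h ⊕_) (sketch-flip hs p e) ⟩
  h ⊕ (g ⊕ P)                        ≡⟨ ⊕-assoc h g P ⟨
  (h ⊕ g) ⊕ P                        ≡⟨ cong (_⊕ P) (⊕-comm h g) ⟩
  (g ⊕ h) ⊕ P                        ≡⟨ ⊕-assoc g h P ⟩
  g ⊕ (h ⊕ P)                        ∎
  where
  open ≡-Reasoning
  g = lookup hs e
  P = sketch hs p

-- In coding terms: the code with parity-check columns `hs` has minimum distance greater than `D`.
Independent : ∀ {r N} → ℕ → Vec (Vec Bool r) N → Set
Independent D hs = ∀ p → ∣ p ∣ ≤ D → sketch hs p ≡ 𝟘 → p ≡ ⊥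

-- The symmetric difference has sketch zero and at most `d + d` elements, hence is empty.
sketch-injective : ∀ {r N d} {hs : Vec (Vec Bool r) N} → Independent (d + d) hs →
                   ∀ {p q} → ∣ p ∣ ≤ d → ∣ q ∣ ≤ d → sketch hs p ≡ sketch hs q → p ≡ q
sketch-injective {hs = hs} ind {p} {q} ∣p∣≤d ∣q∣≤d eq =
  x⊕y≡𝟘⇒x≡y p q (ind (p ⊕ q)
    (≤-trans (∣p⊕q∣≤∣p∣+∣q∣ p q) (+-mono-≤ ∣p∣≤d ∣q∣≤d))
    (trans (sketch-⊕ hs p q) (trans (cong (_⊕ sketch hs q) eq) (⊕-same _))))

-- Columns without short dependencies

split-heads : ∀ {r} (l : List (Vec Bool (suc r))) →
              Σ (List (Vec Bool r)) λ fs → Σ (List (Vec Bool r)) λ ts →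
                length fs + length ts ≡ length l ×
                (∀ {x} → false ∷ x ∈ˡ l → x ∈ˡ fs) × (∀ {x} → true ∷ x ∈ˡ l → x ∈ˡ ts)
split-heads [] = [] , [] , refl , (λ ()) , (λ ())
split-heads ((b ∷ x) ∷ l) with split-heads l
split-heads ((false ∷ x) ∷ l) | fs , ts , len , f∈ , t∈ =
  x ∷ fs , ts , cong suc len ,
  (λ { (here refl) → here refl ; (there i) → there (f∈ i) }) ,
  (λ { (here ()) ; (there i) → t∈ i })
split-heads ((true ∷ x) ∷ l) | fs , ts , len , f∈ , t∈ =
  fs , x ∷ ts , trans (+-suc (length fs) (length ts)) (cong suc len) ,
  (λ { (here ()) ; (there i) → f∈ i }) ,
  (λ { (here refl) → here refl ; (there i) → there (t∈ i) })

-- Pigeonhole by bisection: one of the two lists of tails is shorter than `2 ^ r`, and a vector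
-- missing from it is extended by the corresponding head bit.
fresh : ∀ r (l : List (Vec Bool r)) → length l < 2 ^ r → ∃ λ h → h ∉ˡ l
fresh zero    []      _        = [] , λ ()
fresh zero    (_ ∷ _) (s≤s ())
fresh (suc r) l       l<       with split-heads l
... | fs , ts , len , f∈ , t∈ with length fs <? 2 ^ r | length ts <? 2 ^ r
... | yes fs< | _       = let h , h∉ = fresh r fs fs< in false ∷ h , λ i → h∉ (f∈ i)
... | no _    | yes ts< = let h , h∉ = fresh r ts ts< in true ∷ h , λ i → h∉ (t∈ i)
... | no fs≮  | no ts≮  = contradiction l< (≤⇒≯ (begin
  2 ^ suc r              ≡⟨ cong (2 ^ r +_) (+-identityʳ (2 ^ r)) ⟩
  2 ^ r + 2 ^ r          ≤⟨ +-mono-≤ (≮⇒≥ fs≮) (≮⇒≥ ts≮) ⟩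
  length fs + length ts  ≡⟨ len ⟩
  length l               ∎))
  where open ≤-Reasoning

-- These are the values forbidden for the next column; repetitions are kept.
sketches : ∀ {r N} → Vec (Vec Bool r) N → ℕ → List (Vec Bool r)
sketches []       D       = 𝟘 ∷ []
sketches (h ∷ hs) zero    = 𝟘 ∷ []
sketches (h ∷ hs) (suc D) = sketches hs (suc D) ++ map (h ⊕_) (sketches hs D)

∣p∣≤0⇒p≡⊥ : ∀ {N} (p : Subset N) → ∣ p ∣ ≤ 0 → p ≡ ⊥
∣p∣≤0⇒p≡⊥ []          _ = refl
∣p∣≤0⇒p≡⊥ (false ∷ p) z = cong (false ∷_) (∣p∣≤0⇒p≡⊥ p z)

sketch∈sketches : ∀ {r N} (hs : Vec (Vec Bool r) N) D p → ∣ p ∣ ≤ D → sketch hs p ∈ˡ sketches hs D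
sketch∈sketches []       D       []          _       = here refl
sketch∈sketches (h ∷ hs) zero    p           ∣p∣≤0   =
  here (trans (cong (sketch (h ∷ hs)) (∣p∣≤0⇒p≡⊥ p ∣p∣≤0)) (sketch-⊥ hs))
sketch∈sketches (h ∷ hs) (suc D) (false ∷ p) ∣p∣≤    = ∈-++⁺ˡ (sketch∈sketches hs (suc D) p ∣p∣≤)
sketch∈sketches (h ∷ hs) (suc D) (true  ∷ p) (s≤s ∣p∣≤) =
  ∈-++⁺ʳ (sketches hs (suc D)) (∈-map⁺ (h ⊕_) (sketch∈sketches hs D p ∣p∣≤))

-- The length obeys Pascal's recursion and is a sum of binomial coefficients; the power is a crude
-- bound on it.
length-sketches : ∀ {r N} (hs : Vec (Vec Bool r) N) D → length (sketches hs D) ≤ suc N ^ D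
length-sketches         []       D       = m^n>0 1 D
length-sketches         (h ∷ hs) zero    = s≤s z≤n
length-sketches {N = suc N} (h ∷ hs) (suc D) = begin
  length (sketches hs (suc D) ++ map (h ⊕_) (sketches hs D))
    ≡⟨ length-++ (sketches hs (suc D)) ⟩
  length (sketches hs (suc D)) + length (map (h ⊕_) (sketches hs D))
    ≡⟨ cong (length (sketches hs (suc D)) +_) (length-map (h ⊕_) (sketches hs D)) ⟩
  length (sketches hs (suc D)) + length (sketches hs D)
    ≤⟨ +-mono-≤ (length-sketches hs (suc D)) (length-sketches hs D) ⟩
  suc N * suc N ^ D + suc N ^ D
    ≡⟨ +-comm (suc N * suc N ^ D) (suc N ^ D) ⟩
  suc (suc N) * suc N ^ D
    ≤⟨ *-monoʳ-≤ (suc (suc N)) (^-monoˡ-≤ D (n≤1+n (suc N))) ⟩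
  suc (suc N) ^ suc D ∎
  where open ≤-Reasoning

-- Greedy choice: the new column avoids every sketch of at most `D` old ones, while a short
-- dependency involving it would equate it with such a sketch.
independent-columns : ∀ {r} D N → N ^ D < 2 ^ r → Σ (Vec (Vec Bool r) N) (Independent D)
independent-columns {r} D zero _ = [] , λ { [] _ _ → refl }
independent-columns {r} D (suc N) N^D<2^r
  with hs , ind ← independent-columns {r} D N (≤-<-trans (^-monoˡ-≤ D (n≤1+n N)) N^D<2^r)
  with h , h∉ ← fresh r (sketches hs D) (≤-<-trans (length-sketches hs D) N^D<2^r)
  = h ∷ hs , λ where
    (false ∷ p) ∣p∣≤D eq → cong (false ∷_) (ind p ∣p∣≤D eq)
    (true  ∷ p) ∣p∣<D eq → contradiction
      (subst (_∈ˡ sketches hs D) (sym (x⊕y≡𝟘⇒x≡y h (sketch hs p) eq))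
        (sketch∈sketches hs D p (<⇒≤ ∣p∣<D)))
      h∉

-- The streaming algorithm

Loopless : ∀ {n} → EdgeState n → Set
Loopless X = ∀ {x y} → X x y ≡ true → x ≢ y

-- Looplessness is part of the invariant because the edge cover, and with it the sparsity bound,
-- concerns edges between distinct vertices.
record Represents {n : ℕ} (p : Subset (n * n)) (X : EdgeState n) : Set where
  constructor _,_
  field
    agree    : ∀ x y → lookup p (combine x y) ≡ X x y
    loopless : Loopless X

flip : ∀ {N} → Subset N → Fin N → Subset N
flip p e = updateAt p e not

∣flip∣-out : ∀ {N} (p : Subset N) e → lookup p e ≡ false → ∣ flip p e ∣ ≡ suc ∣ p ∣
∣flip∣-out (false ∷ p) zero    _  = refl
∣flip∣-out (false ∷ p) (suc e) eq = ∣flip∣-out p e eq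
∣flip∣-out (true  ∷ p) (suc e) eq = cong suc (∣flip∣-out p e eq)

∣flip∣-in : ∀ {N} (p : Subset N) e → lookup p e ≡ true → ∣ flip p e ∣ ≡ pred ∣ p ∣
∣flip∣-in p e eq = cong pred (trans (sym (∣flip∣-out (flip p e) e (trans (lookup∘updateAt e p) (cong not eq)))) (cong ∣_∣ flip-flip))
  where
  flip-flip : flip (flip p e) e ≡ p
  flip-flip = trans (updateAt-updateAt e p) (updateAt-id-local e p (not-involutive _))

-- In a valid stream every update changes the stored bit, so setting it amounts to flipping it;
-- `u < v` keeps loops out.
flip-represents : ∀ {n} {p : Subset (n * n)} {X : EdgeState n} → Represents p X →
                  ∀ {u v} b → toℕ u < toℕ v → X u v ≡ not b → Represents (flip p (combine u v)) (setES X u v b)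
flip-represents {p = p} {X} (agree , loopless) {u} {v} b u<v old = agree′ , loopless′
  where
  agree′ : ∀ x y → lookup (flip p (combine u v)) (combine x y) ≡ setES X u v b x y
  agree′ x y with x ≟ u | y ≟ v
  ... | yes refl | yes refl = begin
    lookup (flip p (combine x y)) (combine x y)  ≡⟨ lookup∘updateAt (combine x y) p ⟩
    not (lookup p (combine x y))                 ≡⟨ cong not (trans (agree x y) old) ⟩
    not (not b)                                  ≡⟨ not-involutive b ⟩
    b                                            ∎
    where open ≡-Reasoning
  ... | no x≢u   | _        = trans (lookup∘updateAt′ _ _ (x≢u ∘ combine-injectiveˡ x y u v) p) (agree x y)
  ... | yes _    | no y≢v   = trans (lookup∘updateAt′ _ _ (y≢v ∘ combine-injectiveʳ x y u v) p) (agree x y)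
  loopless′ : Loopless (setES X u v b)
  loopless′ {x} {y} e with x ≟ u | y ≟ v
  ... | yes refl | yes refl = λ { refl → <-irrefl refl u<v }
  ... | no _     | _        = loopless e
  ... | yes _    | no _     = loopless e

adjacency : ∀ {n} → Subset (n * n) → Adj n
adjacency p x y = lookup p (combine x y) ∨ lookup p (combine y x)

adjacency-sym : ∀ {n} (p : Subset (n * n)) → Symmetric (adjacency {n} p)
adjacency-sym p {x} {y} = trans (∨-comm (lookup p (combine y x)) _)

treewidth-mono : ∀ {n k} {E E′ : Rel′ n} → (∀ {x y} → E′ x y → E x y) → TreewidthAtMost k E → TreewidthAtMost k E′
treewidth-mono E′⊆E td = record
  { m = m ; T = T ; tree = tree ; bag = bag ; vertexCov = vertexCov
  ; edgeCov = λ u v → edgeCov u v ∘ E′⊆E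
  ; coherent = coherent ; width≤k = width≤k
  }
  where open TreeDecomposition td

-- Twice k n: the edge cover does not say in which orientation an edge is stored, so both
-- are counted.
sparsity : ℕ → ℕ → ℕ
sparsity n k = n * k + n * k

elim⇒sparse : ∀ {n k} {p : Subset (n * n)} {X : EdgeState n} → Represents p X → Elim k n ⊤ (adjacency {n} p) → ∣ p ∣ ≤ sparsity n k
elim⇒sparse {n} {k} {p} (agree , loopless) el
  with l , len , cover ← elim⇒edge-cover n {E = adjacency {n} p} (λ {x} {y} → adjacency-sym {n} p {x} {y}) el
  = begin
    ∣ p ∣                                       ≤⟨ ∣p∣≤length p (map index l ++ map index′ l) covered ⟩
    length (map index l ++ map index′ l)        ≡⟨ length-++ (map index l) ⟩
    length (map index l) + length (map index′ l) ≡⟨ cong₂ _+_ (length-map index l) (length-map index′ l) ⟩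
    length l + length l                         ≤⟨ +-mono-≤ len len ⟩
    sparsity n k                                ∎
  where
  open ≤-Reasoning
  index index′ : Fin n × Fin n → Fin (n * n)
  index  (x , y) = combine x y
  index′ (x , y) = combine y x
  covered : ∀ {e} → e ∈ p → e ∈ˡ map index l ++ map index′ l
  covered {e} e∈p with x , y , refl ← combine-surjective {n} {n} e
    with cover ∈⊤ ∈⊤ (loopless (trans (sym (agree x y)) ([]=⇒lookup e∈p))) (∨-≡true⁺ _ (inj₁ ([]=⇒lookup e∈p)))
  ... | inj₁ i = ∈-++⁺ˡ (∈-map⁺ index i)
  ... | inj₂ i = ∈-++⁺ʳ (map index l) (∈-map⁺ index′ i)

take-++ : ∀ {A : Set} {m n} (xs : Vec A m) (ys : Vec A n) → take m (xs ++ᵛ ys) ≡ xs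
take-++ []       ys = refl
take-++ (x ∷ xs) ys = cong (x ∷_) (take-++ xs ys)

drop-++ : ∀ {A : Set} {m n} (xs : Vec A m) (ys : Vec A n) → drop m (xs ++ᵛ ys) ≡ ys
drop-++ []       ys = refl
drop-++ (x ∷ xs) ys = drop-++ xs ys

edge : ∀ {n} → Update n → Fin (n * n)
edge (ins u v) = combine u v
edge (del u v) = combine u v

recount : ∀ {n} → Update n → ℕ → ℕ
recount (ins _ _) = suc
recount (del _ _) = pred

module Sketching (n k : ℕ) {r c : ℕ} {hs : Vec (Vec Bool r) (n * n)}
                 (independent : Independent (sparsity n k + sparsity n k) hs) (n*n<2^c : n * n < 2 ^ c) where

  private
    d = sparsity n k

  state : Subset (n * n) → Vec Bool (r + c)
  state p = sketch hs p ++ᵛ toBits c ∣ p ∣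

  state-sketch : ∀ p → take r (state p) ≡ sketch hs p
  state-sketch p = take-++ (sketch hs p) _

  state-count : ∀ p → fromBits (drop r (state p)) ≡ ∣ p ∣
  state-count p = trans (cong fromBits (drop-++ (sketch hs p) (toBits c ∣ p ∣)))
                        -- The counter never overflows, as there are only `n * n` ordered pairs.
                        (fromBits-toBits c (≤-<-trans (∣p∣≤n p) n*n<2^c))

  step : Vec Bool (r + c) → Update n → Vec Bool (r + c)
  step σ t = (lookup hs (edge t) ⊕ take r σ) ++ᵛ toBits c (recount t (fromBits (drop r σ)))

  step-state : ∀ p t → ∣ flip p (edge t) ∣ ≡ recount t ∣ p ∣ → step (state p) t ≡ state (flip p (edge t))
  step-state p t count = cong₂ _++ᵛ_
    (trans (cong (lookup hs (edge t) ⊕_) (state-sketch p)) (sym (sketch-flip hs p (edge t))))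
    (cong (toBits c) (trans (cong (recount t) (state-count p)) (sym count)))

  -- The invariant: the memory is determined by the current edge set alone, whatever the history.
  run-state : ∀ s {p} {X : EdgeState n} → Represents p X → Valid X s →
              ∃ λ q → foldl step (state p) s ≡ state q × Represents q (runES X s)
  run-state []            {p} rep _ = p , refl , rep
  run-state (ins u v ∷ s) {p} rep (u<v , old , valid)
    with q , eq , rep′ ← run-state s (flip-represents {p = p} rep true u<v old) valid
    = q , trans (cong (λ σ → foldl step σ s) (step-state p (ins u v) (∣flip∣-out p _ (trans (Represents.agree rep u v) old)))) eq , rep′
  run-state (del u v ∷ s) {p} rep (u<v , old , valid)
    with q , eq , rep′ ← run-state s (flip-represents {p = p} rep false u<v old) valid
    = q , trans (cong (λ σ → foldl step σ s) (step-state p (del u v) (∣flip∣-in p _ (trans (Represents.agree rep u v) old)))) eq , rep′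

  -- The count test ensures that the current edge set is sparse; otherwise a different sparse set
  -- with the same sketch could be mistaken for it.
  Accepting : Vec Bool (r + c) → Set
  Accepting σ = fromBits (drop r σ) ≤ d × ∃ λ p → ∣ p ∣ ≤ d × sketch hs p ≡ take r σ × Elim k n ⊤ (adjacency {n} p)

  accepting? : ∀ σ → Dec (Accepting σ)
  accepting? σ = (_ ≤? d) ×-dec anySubset? λ p →
    (∣ p ∣ ≤? d) ×-dec (≡-dec Bool._≟_ _ _ ×-dec elim? k n ⊤ (adjacency {n} p))

  -- Forwards, both sets are sparse, so injectivity identifies the set found with the current one.
  -- Backwards, an elimination order makes the current set sparse, and it is its own witness.
  accepting-state : ∀ {q} {X : EdgeState n} → Represents q X → Accepting (state q) ⇔ Elim k n ⊤ (adjacency {n} q)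
  accepting-state {q} rep = mk⇔
    (λ (count≤d , p , ∣p∣≤d , eq , el) → subst (λ p → Elim k n ⊤ (adjacency {n} p))
       (sketch-injective {hs = hs} independent ∣p∣≤d (subst (_≤ d) (state-count q) count≤d) (trans eq (state-sketch q))) el)
    (λ el → let ∣q∣≤d = elim⇒sparse {p = q} rep el in
       subst (_≤ d) (sym (state-count q)) ∣q∣≤d , q , ∣q∣≤d , sym (state-sketch q) , el)

  algorithm : StreamAlg (Update n) (r + c)
  algorithm = record { init = state ⊥ ; step = step ; accept = λ σ → ⌊ accepting? σ ⌋ }

  algorithm-correct : ∀ s → Valid emptyES s → runAlg algorithm s ≡ true ⇔ TreewidthAtMost k (graphOf s)
  algorithm-correct s valid
    with q , eq , rep@(agree , _) ← run-state s {⊥} {emptyES} ((λ x y → lookup-replicate (combine x y) false) , λ ()) valid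
    rewrite eq = mk⇔
      (λ acc → treewidth-mono (λ {x} {y} → to x y) (elim⇒treewidth n (λ {x} {y} → adjacency-sym {n} q {x} {y})
         (Equivalence.to (accepting-state rep) (toWitness (Equivalence.from T-≡ acc)))))
      (λ tw → Equivalence.to T-≡ (fromWitness (Equivalence.from (accepting-state rep)
         (treewidth⇒elim (treewidth-mono (λ {x} {y} → from x y) tw)))))
    where
    to : ∀ x y → graphOf s x y → adjacency {n} q x y ≡ true
    to x y (inj₁ e) = ∨-≡true⁺ _ (inj₁ (trans (agree x y) e))
    to x y (inj₂ e) = ∨-≡true⁺ _ (inj₂ (trans (agree y x) e))
    from : ∀ x y → adjacency {n} q x y ≡ true → graphOf s x y
    from x y e with ∨-≡true⁻ (lookup q (combine x y)) e
    ... | inj₁ e′ = inj₁ (trans (sym (agree x y)) e′)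
    ... | inj₂ e′ = inj₂ (trans (sym (agree y x)) e′)

-- Space bounds and the two stream models

sketchBits : ℕ → ℕ → ℕ
sketchBits n k = suc (2 * word n * (sparsity n k + sparsity n k))

countBits : ℕ → ℕ
countBits n = 2 * word n

-- A vertex pair takes `2 * word n` bits, to be raised to the power `D`. The extra bit makes the
-- inequality strict even for `D = 0`.
sketchBits-suffice : ∀ n k → (n * n) ^ (sparsity n k + sparsity n k) < 2 ^ sketchBits n k
sketchBits-suffice n k = begin-strict
  (n * n) ^ D               ≤⟨ ^-monoˡ-≤ D (<⇒≤ (n*n<2^2word n)) ⟩
  (2 ^ (2 * word n)) ^ D    ≡⟨ ^-*-assoc 2 (2 * word n) D ⟩
  2 ^ (2 * word n * D)      <⟨ ^-monoʳ-< 2 (s≤s (s≤s z≤n)) (n<1+n (2 * word n * D)) ⟩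
  2 ^ sketchBits n k        ∎
  where
  open ≤-Reasoning
  D = sparsity n k + sparsity n k

-- Four copies of `n * k` at `2 * word n` bits each give the 8; the `+ 1` in the bound absorbs the
-- counter and the extra bit.
space : ∀ n k → sketchBits n k + countBits n ≤ 8 * (k * n + 1) * word n
-- The slack is `8 - 2 = 6` words less the extra bit: `6 * (l + 1)` minus one, that is `6 * l + 5`.
space n k = subst (b ≤_) (identity ⌈log₂ n ⌉ n k) (m≤m+n b (6 * ⌈log₂ n ⌉ + 5))
  where
  b = sketchBits n k + countBits n
  identity : ∀ l n k → suc (2 * (l + 1) * ((n * k + n * k) + (n * k + n * k))) + 2 * (l + 1) + (6 * l + 5)
                       ≡ 8 * (k * n + 1) * (l + 1)
  identity = solve 3 (λ l n k →
    con 1 :+ con 2 :* (l :+ con 1) :* ((n :* k :+ n :* k) :+ (n :* k :+ n :* k)) :+ con 2 :* (l :+ con 1) :+ (con 6 :* l :+ con 5)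
      := con 8 :* (k :* n :+ con 1) :* (l :+ con 1)) refl

treewidth-stream : ∀ n k → Σ (StreamAlg (Update n) (sketchBits n k + countBits n)) λ A →
  ∀ s → Valid emptyES s → runAlg A s ≡ true ⇔ TreewidthAtMost k (graphOf s)
treewidth-stream n k
  with hs , independent ← independent-columns {sketchBits n k} (sparsity n k + sparsity n k) (n * n) (sketchBits-suffice n k)
  = algorithm , algorithm-correct
  where open Sketching n k {c = countBits n} {hs} independent (n*n<2^2word n)

insertionOnly : ∀ {n b} → StreamAlg (Update n) b → StreamAlg (Fin n × Fin n) b
insertionOnly A = record { init = init ; step = λ σ e → step σ (ins (proj₁ e) (proj₂ e)) ; accept = accept }
  where open StreamAlg A

run-insertionOnly : ∀ {n b} (A : StreamAlg (Update n) b) s → runAlg A (insertions s) ≡ runAlg (insertionOnly A) s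
run-insertionOnly A s = cong accept (same-memory s init)
  where
  open StreamAlg A
  same-memory : ∀ s σ → foldl step σ (insertions s) ≡ foldl (StreamAlg.step (insertionOnly A)) σ s
  same-memory []            σ = refl
  same-memory ((u , v) ∷ s) σ = same-memory s (step σ (ins u v))

theorem24 : (Σ ℕ λ C → ∀ (n k : ℕ) → Σ ℕ λ b → b ≤ C * (k * n + 1) * word n ×
    Σ (StreamAlg (Fin n × Fin n) b) λ A →
    ∀ (s : List (Fin n × Fin n)) → Valid emptyES (insertions s) →
    (runAlg A s ≡ true ⇔ TreewidthAtMost k (graphOf (insertions s))))
    ×
    (Σ ℕ λ C → Σ ℕ λ c → ∀ (n k : ℕ) → Σ ℕ λ b → b ≤ C * (k * n + 1) * word n ^ c ×
    Σ (StreamAlg (Update n) b) λ A →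
    ∀ (s : List (Update n)) → Valid emptyES s →
    (runAlg A s ≡ true ⇔ TreewidthAtMost k (graphOf s)))
theorem24 =
  -- The algorithm for insertions and deletions is run on insertions only.
  ( 8 , λ n k → let A , correct = treewidth-stream n k in
      _ , space n k , insertionOnly A , λ s valid →
        subst (λ answer → answer ≡ true ⇔ TreewidthAtMost k (graphOf (insertions s)))
          (run-insertionOnly A s) (correct (insertions s) valid) )
  ,
  -- With exponent `1` the only logarithmic factor is the length of one word.
  ( 8 , 1 , λ n k →
      _ , subst (λ w → sketchBits n k + countBits n ≤ 8 * (k * n + 1) * w) (sym (^-identityʳ (word n))) (space n k) ,
      treewidth-stream n k )
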